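{- Let $k\ge 2$. In the game described in the context (starting from the empty board), Builder has a strategy such that, against every strategy of Painter, at least one of the following occurs: a red $P_3$ or a blue $P_3$ appears within the first $6k-5$ rounds; or after at most $6k-6$ rounds the board contains a bad green $P_{4k-3}$; or after at most $6k-5$ rounds the board contains a good green $P_{4k-3}$.
   Context: $P_m$ denotes the path on $m$ vertices. Game: Builder and Painter play on an infinite vertex set, initially with no edges; in each round Builder draws an edge between two nonadjacent vertices and Painter immediately colors it red, blue or green. A green path is a path all of whose edges are green. A green path is called good if at least one of its endpoints is incident to a red or blue edge, and bad otherwise. -}

module Defs where

open import Data.Nat using (ℕ; zero; suc)
open import Data.List using (List; []; _∷_; length)
open import Data.List.Relation.Unary.Any using (Any)
open import Data.List.Relation.Unary.Unique.Propositional using (Unique)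
open import Data.Product using (Σ; ∃; _×_; _,_; proj₁; proj₂)
open import Data.Sum using (_⊎_)
open import Data.Unit using (⊤)
open import Relation.Nullary using (¬_)
open import Relation.Binary.PropositionalEquality using (_≡_; _≢_)

data Colour : Set where
  red blue green : Colour

Vertex : Set
Vertex = ℕ

-- A coloured edge {u,v} (stored as an ordered pair, read as unordered).
ColEdge : Set
ColEdge = Vertex × Vertex × Colour

-- The board / full history of the game: list of coloured edges,
-- most recent first.
Board : Set
Board = List ColEdge

HasEdge : Board → Colour → Vertex → Vertex → Set
HasEdge B c u v =
  Any (λ e → (proj₂ (proj₂ e) ≡ c) ×
             ((proj₁ e ≡ u × proj₁ (proj₂ e) ≡ v) ⊎
              (proj₁ e ≡ v × proj₁ (proj₂ e) ≡ u))) B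

Adjacent : Board → Vertex → Vertex → Set
Adjacent B u v = ∃ λ c → HasEdge B c u v

Legal : Board → Vertex × Vertex → Set
Legal B (u , v) = u ≢ v × ¬ Adjacent B u v

BuilderStrategy : Set
BuilderStrategy = (B : Board) → Σ (Vertex × Vertex) (Legal B)

PainterStrategy : Set
PainterStrategy = Board → Vertex × Vertex → Colour

play : BuilderStrategy → PainterStrategy → ℕ → Board
play b p zero = []
play b p (suc n) =
  let B = play b p n
      e = proj₁ (b B)
  in (proj₁ e , proj₂ e , p B e) ∷ B

Consecutive : Board → Colour → List Vertex → Set
Consecutive B c [] = ⊤
Consecutive B c (x ∷ []) = ⊤
Consecutive B c (x ∷ y ∷ r) = HasEdge B c x y × Consecutive B c (y ∷ r)

IsPath : Board → Colour → ℕ → Vertex → List Vertex → Set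
IsPath B c m x xs =
  length (x ∷ xs) ≡ m × Unique (x ∷ xs) × Consecutive B c (x ∷ xs)

HasMonoPath : Board → Colour → ℕ → Set
HasMonoPath B c m = ∃ λ x → ∃ λ xs → IsPath B c m x xs

lastOf : Vertex → List Vertex → Vertex
lastOf x [] = x
lastOf x (y ∷ ys) = lastOf y ys

IncidentRB : Board → Vertex → Set
IncidentRB B v = ∃ λ u → HasEdge B red v u ⊎ HasEdge B blue v u

HasGoodGreenPath : Board → ℕ → Set
HasGoodGreenPath B m = ∃ λ x → ∃ λ xs →
  IsPath B green m x xs × (IncidentRB B x ⊎ IncidentRB B (lastOf x xs))

HasBadGreenPath : Board → ℕ → Set
HasBadGreenPath B m = ∃ λ x → ∃ λ xs →
  IsPath B green m x xs × ¬ IncidentRB B x × ¬ IncidentRB B (lastOf x xs)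

{-# OPTIONS --safe #-}
module Submission where

-- Unless Painter makes a red or blue P₃, an edge uv is forced to be green as soon as u or v touches a
-- red edge and u or v touches a blue one.  Write N = k - 1.  Builder keeps a green path with 4i edges in
-- one of two positions: calm, after at most 6i rounds; or hot, after at most 6i + 1 rounds, where the
-- head x of the path and a vertex z off the path, not adjacent to the last vertex y, touch edges of the
-- same non-green colour.  In both positions, and on the empty board, a finite strategy that stays within
-- x, y, z and fresh vertices makes the path four edges longer and leads to a calm or hot position for
-- i + 1, in 6 rounds (plus or minus one if the kind of position changes).  At i = N a calm position
-- gives a good or bad path and a hot one a good path, in time.
--
-- The engine in a hot position, with red as common colour, is the alternating path: a new edge zw is
-- green or blue, and after blue a new edge wu is green or red.  If red, then w and z are saturated,
-- every further edge at them is green, and y w f z g extends the path while x and u are both red.  If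
-- green, then x w u z f extends it.


open import Defs
open import Data.Nat using (ℕ; zero; suc; _+_; _*_; _∸_; _≤_; _<_; _≤?_; _<?_; _≟_; _⊔_; z≤n; s≤s)
open import Data.Nat.Properties
open import Data.List using (List; []; _∷_; _++_; _ʳ++_; length; map)
open import Data.List.Properties using (length-++; length-map)
open import Data.List.Relation.Unary.All as All using (All; []; _∷_)
import Data.List.Relation.Unary.All.Properties as All
open import Data.List.Relation.Unary.Any as Any using (Any; here; there; any?)
import Data.List.Relation.Unary.Any.Properties as Any
open import Data.List.Relation.Unary.AllPairs using ([]; _∷_)
open import Data.List.Relation.Unary.Unique.Propositional using (Unique)
open import Data.List.Membership.Propositional using (_∈_; _∉_)
open import Data.List.Membership.DecPropositional _≟_ using (_∈?_; _∉?_)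
open import Data.Maybe using (Maybe; just; nothing)
open import Data.Product using (Σ; ∃; _×_; _,_; proj₁; proj₂)
open import Data.Product.Properties using (≡-dec)
open import Data.Sum using (_⊎_; inj₁; inj₂; [_,_]′)
open import Data.Unit using (⊤; tt)
open import Data.Empty using (⊥-elim)
open import Function using (_∘_; id)
open import Relation.Nullary using (¬_; Dec; yes; no; ¬?; _×-dec_; _⊎-dec_)
open import Relation.Nullary.Decidable using (toWitness; map′)
open import Relation.Binary.Definitions using (DecidableEquality)
open import Relation.Binary.PropositionalEquality using (_≡_; _≢_; refl; sym; trans; cong; subst)

-- Game trees

-- A finite strategy, indexed by the board and hence by the full history. Round bounds can therefore
-- enter `G` as bounds on the length of the board.
data Tree (G : Board → Set) (B : Board) : Set where
  done : G B → Tree G B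
  move : ∀ u v → Legal B (u , v) → (∀ c → Tree G ((u , v , c) ∷ B)) → Tree G B

_≟ᶜ_ : DecidableEquality Colour
red   ≟ᶜ red   = yes refl
red   ≟ᶜ blue  = no λ ()
red   ≟ᶜ green = no λ ()
blue  ≟ᶜ red   = no λ ()
blue  ≟ᶜ blue  = yes refl
blue  ≟ᶜ green = no λ ()
green ≟ᶜ red   = no λ ()
green ≟ᶜ blue  = no λ ()
green ≟ᶜ green = yes refl

Below : ℕ → Board → Set
Below b = All (λ e → proj₁ e < b × proj₁ (proj₂ e) < b)

below-mono : ∀ {b b′ B} → b ≤ b′ → Below b B → Below b′ B
below-mono b≤b′ = All.map λ (p , q) → <-≤-trans p b≤b′ , <-≤-trans q b≤b′

adjacent-below : ∀ {b B u v} → Below b B → Adjacent B u v → u < b × v < b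
adjacent-below (p ∷ _) (c , here (_ , inj₁ (refl , refl))) = p
adjacent-below ((p , q) ∷ _) (c , here (_ , inj₂ (refl , refl))) = q , p
adjacent-below (_ ∷ ps) (c , there h) = adjacent-below ps (c , h)

bound : Board → ℕ
bound [] = 0
bound ((u , v , _) ∷ B) = suc (u ⊔ v) ⊔ bound B

bound-below : ∀ B → Below (bound B) B
bound-below [] = []
bound-below ((u , v , _) ∷ B) =
  (m≤n⇒m≤n⊔o (bound B) (s≤s (m≤m⊔n u v)) , m≤n⇒m≤n⊔o (bound B) (s≤s (m≤n⊔m u v)))
  ∷ below-mono (m≤n⊔m (suc (u ⊔ v)) (bound B)) (bound-below B)

-- Fallback once a leaf is reached or the history has left the tree.
legalMove : ∀ B → Σ (Vertex × Vertex) (Legal B)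
legalMove B = (b , suc b) , (1+n≢n ∘ sym) , λ a → <-irrefl refl (proj₁ (adjacent-below (bound-below B) a))
  where b = bound B

module Strategy {G : Board → Set} (root : Tree G []) where

  -- A Builder strategy sees only the board; replaying this history through the tree recovers the
  -- node at which the play stands.
  descend : ∀ {B} (e : ColEdge) → Maybe (Tree G B) → Maybe (Tree G (e ∷ B))
  descend (u , v , c) (just (move u′ v′ _ next)) with ≡-dec _≟_ _≟_ (u′ , v′) (u , v)
  ... | yes refl = just (next c)
  ... | no _     = nothing
  descend _ _ = nothing

  locate : ∀ B → Maybe (Tree G B)
  locate []      = just root
  locate (e ∷ B) = descend e (locate B)

  choose : ∀ B → Maybe (Tree G B) → Σ (Vertex × Vertex) (Legal B)
  choose B (just (move u v legal _)) = (u , v) , legal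
  choose B _ = legalMove B

  strategy : BuilderStrategy
  strategy B = choose B (locate B)

  descend-move : ∀ {B} u v (l : Legal B (u , v)) next c →
    descend (u , v , c) (just (move u v l next)) ≡ just (next c)
  descend-move u v l next c with ≡-dec _≟_ _≟_ (u , v) (u , v)
  ... | yes refl = refl
  ... | no ≢     = ⊥-elim (≢ refl)

  module _ (p : PainterStrategy) where

    follow : ∀ n {B} → play strategy p n ≡ B → (T : Tree G B) → locate B ≡ just T →
      ∃ λ n → G (play strategy p n)
    follow n refl (done g) _ = n , g
    follow n {B} refl (move u v l next) eq =
      follow (suc n) {(u , v , c) ∷ B} step (next c) located
      where
      c = p B (u , v)
      step : play strategy p (suc n) ≡ (u , v , c) ∷ B
      step rewrite eq = refl
      located : locate ((u , v , c) ∷ B) ≡ just (next c)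
      located rewrite eq = descend-move u v l next c

    reaches : ∃ λ n → G (play strategy p n)
    reaches = follow 0 refl root refl

length-play : ∀ s p n → length (play s p n) ≡ n
length-play s p zero = refl
length-play s p (suc n) = cong suc (length-play s p n)

-- Green paths, incidences and the positions between two stages

Path : Board → Vertex → List Vertex → Set
Path B x xs = Unique (x ∷ xs) × Consecutive B green (x ∷ xs)

-- A bare `Board` may contain loops; `w ≢ v` rules them out, so that `clash-path` gets three
-- distinct vertices.
Inc : Board → Colour → Vertex → Set
Inc B c v = ∃ λ w → w ≢ v × HasEdge B c v w

data NonGreen : Colour → Set where
  red  : NonGreen red
  blue : NonGreen blue

hasEdge-sym : ∀ {B c u v} → HasEdge B c u v → HasEdge B c v u
hasEdge-sym = Any.map λ (p , q) → p , [ inj₂ , inj₁ ]′ q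

inc-∷ : ∀ {B c v e} → Inc B c v → Inc (e ∷ B) c v
inc-∷ (w , w≢v , h) = w , w≢v , there h

-- The old neighbour `w` differs from the far end of the new edge, since that edge was not on the
-- board before.
clash-path : ∀ {B c u v} → Legal B (u , v) → Inc B c u ⊎ Inc B c v → HasMonoPath ((u , v , c) ∷ B) c 3
clash-path {c = c} {u} {v} (u≢v , ¬adj) (inj₁ (w , w≢u , h)) =
  w , u ∷ v ∷ [] , refl
  , (w≢u ∷ (λ { refl → ¬adj (c , h) }) ∷ []) ∷ (u≢v ∷ []) ∷ [] ∷ []
  , there (hasEdge-sym h) , here (refl , inj₁ (refl , refl)) , tt
clash-path {c = c} {u} {v} (u≢v , ¬adj) (inj₂ (w , w≢v , h)) =
  w , v ∷ u ∷ [] , refl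
  , (w≢v ∷ (λ { refl → ¬adj (c , hasEdge-sym h) }) ∷ []) ∷ ((u≢v ∘ sym) ∷ []) ∷ [] ∷ []
  , there (hasEdge-sym h) , here (refl , inj₂ (refl , refl)) , tt

incidentRB : ∀ {B c v} → NonGreen c → Inc B c v → IncidentRB B v
incidentRB red  (w , _ , h) = w , inj₁ h
incidentRB blue (w , _ , h) = w , inj₂ h

-- Searching the board for a non-green edge at `v` avoids a search over all neighbours. It separates
-- good from bad paths in `calm-goal`.
incidentRB? : ∀ B v → Dec (IncidentRB B v)
incidentRB? B v = map′ to from
  (any? (λ e → ¬? (proj₂ (proj₂ e) ≟ᶜ green) ×-dec ((proj₁ e ≟ v) ⊎-dec (proj₁ (proj₂ e) ≟ v))) B)
  where
  Meets : ColEdge → Set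
  Meets e = proj₂ (proj₂ e) ≢ green × (proj₁ e ≡ v ⊎ proj₁ (proj₂ e) ≡ v)
  to : ∀ {B} → Any Meets B → IncidentRB B v
  to {(u , w , red)   ∷ _} (here (_ , inj₁ refl)) = w , inj₁ (here (refl , inj₁ (refl , refl)))
  to {(u , w , red)   ∷ _} (here (_ , inj₂ refl)) = u , inj₁ (here (refl , inj₂ (refl , refl)))
  to {(u , w , blue)  ∷ _} (here (_ , inj₁ refl)) = w , inj₂ (here (refl , inj₁ (refl , refl)))
  to {(u , w , blue)  ∷ _} (here (_ , inj₂ refl)) = u , inj₂ (here (refl , inj₂ (refl , refl)))
  to {(u , w , green) ∷ _} (here (≢ , _)) = ⊥-elim (≢ refl)
  to (there a) with to a
  ... | u , inj₁ h = u , inj₁ (there h)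
  ... | u , inj₂ h = u , inj₂ (there h)
  end : ∀ {u e} → (proj₁ e ≡ v × proj₁ (proj₂ e) ≡ u) ⊎ (proj₁ e ≡ u × proj₁ (proj₂ e) ≡ v) →
        proj₁ e ≡ v ⊎ proj₁ (proj₂ e) ≡ v
  end = [ inj₁ ∘ proj₁ , inj₂ ∘ proj₂ ]′
  from : IncidentRB B v → Any Meets B
  from (u , inj₁ h) = Any.map (λ {e} (p , q) → subst (_≢ green) (sym p) (λ ()) , end {e = e} q) h
  from (u , inj₂ h) = Any.map (λ {e} (p , q) → subst (_≢ green) (sym p) (λ ()) , end {e = e} q) h

record GreenPath (B : Board) (x y : Vertex) (ℓ : ℕ) (On : Vertex → Set) : Set where
  constructor greenPath
  field
    xs     : List Vertex
    path   : Path B x xs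
    last≡  : lastOf x xs ≡ y
    len    : length xs ≡ ℓ
    within : All On (x ∷ xs)

unique-∷ʳ : ∀ {xs : List Vertex} {v} → Unique xs → v ∉ xs → Unique (xs ++ v ∷ [])
unique-∷ʳ [] v∉ = [] ∷ []
unique-∷ʳ (x∉ ∷ u) v∉ =
  All.++⁺ x∉ ((λ { refl → v∉ (here refl) }) ∷ []) ∷ unique-∷ʳ u (v∉ ∘ there)

consecutive-∷ʳ : ∀ {B c v} x xs → Consecutive B c (x ∷ xs) → HasEdge B c (lastOf x xs) v →
  Consecutive B c (x ∷ xs ++ v ∷ [])
consecutive-∷ʳ x [] _ h = h , tt
consecutive-∷ʳ x (y ∷ ys) (e , es) h = e , consecutive-∷ʳ y ys es h

lastOf-∷ʳ : ∀ x xs v → lastOf x (xs ++ v ∷ []) ≡ v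
lastOf-∷ʳ x [] v = refl
lastOf-∷ʳ x (y ∷ ys) v = lastOf-∷ʳ y ys v

lastOf-∈ : ∀ x xs → lastOf x xs ∈ x ∷ xs
lastOf-∈ x [] = here refl
lastOf-∈ x (y ∷ ys) = there (lastOf-∈ y ys)

consecutive-mono : ∀ {B B′ c} → (∀ {u v} → HasEdge B c u v → HasEdge B′ c u v) →
  ∀ xs → Consecutive B c xs → Consecutive B′ c xs
consecutive-mono f [] _ = tt
consecutive-mono f (x ∷ []) _ = tt
consecutive-mono f (x ∷ y ∷ r) (h , hs) = f h , consecutive-mono f (y ∷ r) hs

module _ {B x y ℓ On} (P : GreenPath B x y ℓ On) where
  open GreenPath P

  extend-head : ∀ {v} → ¬ On v → HasEdge B green x v → ∀ {On′ : Vertex → Set} →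
    (∀ {w} → On w → On′ w) → On′ v → GreenPath B v y (suc ℓ) On′
  extend-head v∉ h weaken on = record
    { xs     = x ∷ xs
    ; path   = All.map (λ onw → λ { refl → v∉ onw }) within ∷ proj₁ path
             , hasEdge-sym h , proj₂ path
    ; last≡  = last≡
    ; len    = cong suc len
    ; within = on ∷ All.map weaken within
    }

  extend-last : ∀ {v} → ¬ On v → HasEdge B green y v → ∀ {On′ : Vertex → Set} →
    (∀ {w} → On w → On′ w) → On′ v → GreenPath B x v (suc ℓ) On′
  extend-last {v} v∉ h weaken on = record
    { xs     = xs ++ v ∷ []
    ; path   = unique-∷ʳ (proj₁ path) (v∉ ∘ All.lookup within)
             , consecutive-∷ʳ x xs (proj₂ path) (subst (λ y → HasEdge B green y v) (sym last≡) h)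
    ; last≡  = lastOf-∷ʳ x xs v
    ; len    = trans (length-++ xs) (trans (+-comm (length xs) 1) (cong suc len))
    ; within = All.++⁺ (All.map weaken within) (on ∷ [])
    }

weaken : ∀ {B x y ℓ} {On On′ : Vertex → Set} → (∀ {v} → On v → On′ v) →
  GreenPath B x y ℓ On → GreenPath B x y ℓ On′
weaken f P = record { GreenPath P ; within = All.map f (GreenPath.within P) }

castLength : ∀ {B x y m n On} → m ≡ n → GreenPath B x y m On → GreenPath B x y n On
castLength refl P = P

record Calm (i : ℕ) (B : Board) : Set where
  constructor calm
  field
    {b}     : ℕ
    {x y}   : Vertex
    clock   : length B ≤ i * 6
    board<b : Below b B
    main    : GreenPath B x y (i * 4) (_< b)

record Hot (i : ℕ) (B : Board) : Set where
  constructor hot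
  field
    {b}      : ℕ
    {x y}    : Vertex
    clock    : length B ≤ suc (i * 6)
    board<b  : Below b B
    main     : GreenPath B x y (i * 4) (_< b)
    {c}      : Colour
    nonGreen : NonGreen c
    {z}      : Vertex
    x-inc    : Inc B c x
    z-inc    : Inc B c z
    z<b      : z < b
    z∉       : z ∉ x ∷ GreenPath.xs main
    y≁z      : ¬ Adjacent B y z

-- For `N` = k - 1, the numbers `suc (N * 6)`, `N * 6` and `suc (N * 4)` are 6k - 5, 6k - 6 and 4k -
-- 3.
Goal : ℕ → Board → Set
Goal N B =
    (length B ≤ suc (N * 6) × (HasMonoPath B red 3 ⊎ HasMonoPath B blue 3))
  ⊎ (length B ≤ N * 6 × HasBadGreenPath B (suc (N * 4)))
  ⊎ (length B ≤ suc (N * 6) × HasGoodGreenPath B (suc (N * 4)))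

calm-goal : ∀ {N B} → Calm N B → Goal N B
calm-goal {N} {B} (calm {x = x} clock _ (greenPath xs (u , e) refl len _))
  with incidentRB? B x | incidentRB? B (lastOf x xs)
... | yes p | _     = inj₂ (inj₂ (m≤n⇒m≤1+n clock , x , xs , (cong suc len , u , e) , inj₁ p))
... | no _  | yes q = inj₂ (inj₂ (m≤n⇒m≤1+n clock , x , xs , (cong suc len , u , e) , inj₂ q))
... | no ¬p | no ¬q = inj₂ (inj₁ (clock , x , xs , (cong suc len , u , e) , ¬p , ¬q))

hot-goal : ∀ {N B} → Hot N B → Goal N B
hot-goal H = inj₂ (inj₂ (clock , x , xs
  , (cong suc len , proj₁ path , proj₂ path) , inj₁ (incidentRB nonGreen x-inc)))
  where open Hot H
        open GreenPath main

-- Local strategies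

-- A plan uses local names: 0 and `last` are the ends of the current path, 2 is the vertex z of a hot
-- position, and names from `fresh` on are vertices not yet on the board.  A leaf lists the vertices to
-- be appended at the head (L) and at the end (R) of the path, from the path outwards.
data Plan : Set where
  ask : (u v : ℕ) (onRed onBlue onGreen : Plan) → Plan
  calm : (L R : List ℕ) → Plan
  hot : (L R : List ℕ) (z : ℕ) → Plan

-- A strict upper bound for the names used in plans.
names : ℕ
names = 10

-- `budget` is the number of rounds in which a calm position must be reached; a hot one may take one
-- more.  The vertices in `coloured` touch an edge of the given colour from the outset.
record Setting : Set where
  field
    last fresh budget : ℕ
    colour            : Colour
    coloured          : List ℕ

module Local (S : Setting) where
  open Setting S

  Joins : ℕ → ℕ → ColEdge → Set
  Joins u v e = (proj₁ e ≡ u × proj₁ (proj₂ e) ≡ v) ⊎ (proj₁ e ≡ v × proj₁ (proj₂ e) ≡ u)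

  joins? : ∀ u v e → Dec (Joins u v e)
  joins? u v (a , b , _) = ((a ≟ u) ×-dec (b ≟ v)) ⊎-dec ((a ≟ v) ×-dec (b ≟ u))

  -- Nonadjacency read off from local data: fresh vertices have no earlier edges, and the pair 1, 2
  -- is covered by `y≁z` of a hot position.
  Apart : Board → ℕ → ℕ → Set
  Apart E u v = (fresh ≤ u ⊎ fresh ≤ v ⊎ (u ≡ 1 × v ≡ 2)) × ¬ Any (Joins u v) E

  apart? : ∀ E u v → Dec (Apart E u v)
  apart? E u v =
    ((fresh ≤? u) ⊎-dec (fresh ≤? v) ⊎-dec ((u ≟ 1) ×-dec (v ≟ 2))) ×-dec ¬? (any? (joins? u v) E)

  Touches : Board → Colour → ℕ → Set
  Touches E c u =
      Any (λ e → proj₂ (proj₂ e) ≡ c × (proj₁ e ≡ u ⊎ proj₁ (proj₂ e) ≡ u)) E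
    ⊎ (c ≡ colour × u ∈ coloured)

  touches? : ∀ E c u → Dec (Touches E c u)
  touches? E c u =
    any? (λ (a , b , c′) → (c′ ≟ᶜ c) ×-dec ((a ≟ u) ⊎-dec (b ≟ u))) E
    ⊎-dec ((c ≟ᶜ colour) ×-dec (u ∈? coloured))

  Admissible : Board → ℕ → ℕ → Set
  Admissible E u v = length E ≤ budget × u < names × v < names × u ≢ v × Apart E u v

  admissible? : ∀ E u v → Dec (Admissible E u v)
  admissible? E u v =
    (length E ≤? budget) ×-dec (u <? names) ×-dec (v <? names) ×-dec ¬? (u ≟ v) ×-dec apart? E u v

  Off : List ℕ → ℕ → Set
  Off used u = u < names × u ≢ 0 × u ≢ last × u ∉ used

  off? : ∀ used u → Dec (Off used u)
  off? used u = (u <? names) ×-dec ¬? (u ≟ 0) ×-dec ¬? (u ≟ last) ×-dec (u ∉? used)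

  Grows : Board → List ℕ → ℕ → List ℕ → Set
  Grows E used a [] = ⊤
  Grows E used a (u ∷ us) = Off used u × HasEdge E green a u × Grows E (u ∷ used) u us

  grows? : ∀ E used a us → Dec (Grows E used a us)
  grows? E used a [] = yes tt
  grows? E used a (u ∷ us) =
    off? used u
    ×-dec any? (λ e → (proj₂ (proj₂ e) ≟ᶜ green) ×-dec joins? a u e) E
    ×-dec grows? E (u ∷ used) u us

  -- `L ʳ++ []` is the accumulator that `Grows` builds along `L`, so the vertices of `R` also avoid
  -- `L`.
  Extends : Board → List ℕ → List ℕ → Set
  Extends E L R = length R + length L ≡ 4 × Grows E [] 0 L × Grows E (L ʳ++ []) last R

  extends? : ∀ E L R → Dec (Extends E L R)
  extends? E L R =
    (length R + length L ≟ 4) ×-dec grows? E [] 0 L ×-dec grows? E (L ʳ++ []) last R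

  Twins : Board → ℕ → ℕ → Colour → Set
  Twins E u z c = Touches E c u × Touches E c z

  -- A red or blue answer must either complete a P₃ or lead to a valid subplan. Validity is
  -- decidable, so the case analysis of a plan is checked by evaluation.
  Valid : Board → Plan → Set
  Valid E (ask u v r b g) =
      Admissible E u v
    × ((Touches E red u ⊎ Touches E red v) ⊎ Valid ((u , v , red) ∷ E) r)
    × ((Touches E blue u ⊎ Touches E blue v) ⊎ Valid ((u , v , blue) ∷ E) b)
    × Valid ((u , v , green) ∷ E) g
  Valid E (calm L R) = length E ≤ budget × Extends E L R
  Valid E (hot L R z) =
      length E ≤ suc budget × Extends E L R
    × (Twins E (lastOf 0 L) z red ⊎ Twins E (lastOf 0 L) z blue)
    × Off (R ʳ++ (L ʳ++ [])) z × Apart E (lastOf last R) z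

  valid? : ∀ E T → Dec (Valid E T)
  valid? E (ask u v r b g) =
    admissible? E u v
    ×-dec ((touches? E red u ⊎-dec touches? E red v) ⊎-dec valid? _ r)
    ×-dec ((touches? E blue u ⊎-dec touches? E blue v) ⊎-dec valid? _ b)
    ×-dec valid? _ g
  valid? E (calm L R) = (length E ≤? budget) ×-dec extends? E L R
  valid? E (hot L R z) =
    (length E ≤? suc budget) ×-dec extends? E L R
    ×-dec (twins? red ⊎-dec twins? blue)
    ×-dec off? (R ʳ++ (L ʳ++ [])) z ×-dec apart? E (lastOf last R) z
    where
    twins? : ∀ c → Dec (Twins E (lastOf 0 L) z c)
    twins? c = touches? E c (lastOf 0 L) ×-dec touches? E c z

-- The plans for the empty board and for calm and hot positions

swap : Plan → Plan
swap (ask u v r b g) = ask u v (swap b) (swap r) (swap g)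
swap T = T

-- Never valid, so it can only stand for an answer that makes a red or blue P₃.
impossible : Plan
impossible = calm [] []

-- A forced green edge: validity requires that both other answers complete a P₃.
join : ℕ → ℕ → Plan → Plan
join u v T = ask u v impossible impossible T

-- The plans assume that red came first; `swap` covers the other case.  Here z is saturated and 4 is blue.
chainPlan : (y z : ℕ) → Plan
chainPlan y z = ask 4 5
  (join y 4 (join 4 6 (join 6 z (join z 7 (hot [] (4 ∷ 6 ∷ z ∷ 7 ∷ []) 5)))))
  impossible
  (join 0 4 (join 5 z (join z 6 (calm (4 ∷ 5 ∷ z ∷ 6 ∷ []) []))))

-- Once `z` 4 is green, the fresh edge 5 6 decides. If it is coloured, every hot leaf below takes
-- the two ends of a coloured edge at 5 as new head and new spare vertex. If it is green, two more
-- green edges attach the pieces `z` 4 and 5 6 to the path.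
hotPlan : (z : ℕ) → Plan
hotPlan z = ask z 4 impossible (chainPlan 1 z) (ask 5 6
  (ask 0 7 impossible
    (join 0 4 (join z 7 (join 7 5 (hot (4 ∷ z ∷ 7 ∷ 5 ∷ []) [] 6))))
    (ask 7 5 impossible
      (join 7 z (join 4 5 (hot (7 ∷ z ∷ 4 ∷ 5 ∷ []) [] 6)))
      (ask 5 z impossible
        (join 1 z (hot (7 ∷ 5 ∷ []) (z ∷ 4 ∷ []) 6))
        (calm (7 ∷ 5 ∷ z ∷ 4 ∷ []) []))))
  (ask 5 7
    (join 0 6 (join 6 z (join 4 5 (hot (6 ∷ z ∷ 4 ∷ 5 ∷ []) [] 7))))
    impossible
    (ask 0 7 impossible
      (join 0 4 (join z 7 (hot (4 ∷ z ∷ 7 ∷ 5 ∷ []) [] 6)))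
      (join 5 z (calm (7 ∷ 5 ∷ z ∷ 4 ∷ []) []))))
  (ask 0 5 impossible
    (join 0 4 (join z 5 (calm (4 ∷ z ∷ 5 ∷ 6 ∷ []) [])))
    (ask 6 z impossible
      (join 1 z (calm (5 ∷ 6 ∷ []) (z ∷ 4 ∷ [])))
      (calm (5 ∷ 6 ∷ z ∷ 4 ∷ []) []))))

-- Here x and z are red, and one edge of the four is already there.
edgePlan : (x y z : ℕ) (l₁ l₂ l₃ l₄ : Plan) → Plan
edgePlan x y z l₁ l₂ l₃ l₄ = ask z 5 impossible
  (join y z (join z 6 (join x 5 l₁)))
  (ask x 6 impossible
    (join x 5 (join z 6 l₂))
    (ask 6 z impossible (join y z l₃) l₄))

greenPlan : (y : ℕ) → Plan
-- With 0 3 green, Builder prolongs greedily through 4, 5, 6; `e`, `t` and `s` take over when the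
-- second, third or fourth edge is the first to be coloured.
greenPlan y = ask 3 4 e (swap e) (ask 4 5 t (swap t) (ask 5 6 s (swap s) (calm (3 ∷ 4 ∷ 5 ∷ 6 ∷ []) [])))
  where
  e = edgePlan 3 y 4
    (calm (3 ∷ 5 ∷ []) (4 ∷ 6 ∷ [])) (calm (3 ∷ 5 ∷ 4 ∷ 6 ∷ []) [])
    (calm (3 ∷ 6 ∷ []) (4 ∷ 5 ∷ [])) (calm (3 ∷ 6 ∷ 4 ∷ 5 ∷ []) [])
  -- If 4 6 is blue, then 4 is saturated, 5 is red and 6 is blue. When `y` 7 is coloured, whichever
  -- of 5 and 6 has the other colour links `y` to 7, and the remaining one becomes the spare vertex.
  t = ask 4 6 impossible
    (ask y 7
      (join y 6 (join 6 7 (hot (3 ∷ 4 ∷ []) (6 ∷ 7 ∷ []) 5)))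
      (join y 5 (join 5 7 (hot (3 ∷ 4 ∷ []) (5 ∷ 7 ∷ []) 6)))
      (join 4 8 (calm (3 ∷ 4 ∷ 8 ∷ []) (7 ∷ []))))
    (ask 6 7
      (ask 6 5 impossible
        (join y 5 (hot (3 ∷ 4 ∷ 6 ∷ []) (5 ∷ []) 7))
        (calm (3 ∷ 4 ∷ 6 ∷ 5 ∷ []) []))
      (join 6 5 (calm (3 ∷ 4 ∷ 6 ∷ 5 ∷ []) []))
      (calm (3 ∷ 4 ∷ 6 ∷ 7 ∷ []) []))
  s = ask 5 7 impossible
    (join 5 8 (calm (3 ∷ 4 ∷ 5 ∷ 8 ∷ []) []))
    (calm (3 ∷ 4 ∷ 5 ∷ 7 ∷ []) [])

calmPlan : Plan
-- A coloured edge 0 3 creates a hot position with 3 as `z`, at the cost of the one round by which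
-- the budgets differ.
calmPlan = ask 0 3 (hotPlan 3) (swap (hotPlan 3)) (greenPlan 1)

-- The path is the single vertex 0, which stands for both ends. In `s`, after 0 3 red and 3 4 green,
-- the edge 3 4 is the one already there for `edgePlan`.
startPlan : Plan
startPlan = ask 0 3 s (swap s) (greenPlan 0)
  where
  s = ask 3 4 impossible (chainPlan 0 3) (edgePlan 3 4 0
    (calm (4 ∷ 3 ∷ 5 ∷ []) (6 ∷ [])) (calm (6 ∷ []) (5 ∷ 3 ∷ 4 ∷ []))
    (calm (4 ∷ 3 ∷ 6 ∷ []) (5 ∷ [])) (calm (5 ∷ []) (6 ∷ 3 ∷ 4 ∷ [])))

-- A hot position may be one round behind, whence budget 5 instead of 6. In `start` every vertex is
-- still fresh and 0 is both ends.
calmSetting start : Setting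
hotSetting : Colour → Setting
calmSetting = record { last = 1 ; fresh = 3 ; budget = 6 ; colour = green ; coloured = [] }
hotSetting c = record { last = 1 ; fresh = 3 ; budget = 5 ; colour = c ; coloured = 0 ∷ 2 ∷ [] }
start = record { last = 0 ; fresh = 0 ; budget = 6 ; colour = green ; coloured = [] }

abstract
  calmPlan-valid : Local.Valid calmSetting [] calmPlan
  calmPlan-valid = toWitness {a? = Local.valid? calmSetting [] calmPlan} tt

  hotPlan-valid-red : Local.Valid (hotSetting red) [] (hotPlan 2)
  hotPlan-valid-red = toWitness {a? = Local.valid? (hotSetting red) [] (hotPlan 2)} tt

  hotPlan-valid-blue : Local.Valid (hotSetting blue) [] (swap (hotPlan 2))
  hotPlan-valid-blue = toWitness {a? = Local.valid? (hotSetting blue) [] (swap (hotPlan 2))} tt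

  startPlan-valid : Local.Valid start [] startPlan
  startPlan-valid = toWitness {a? = Local.valid? start [] startPlan} tt

-- Executing a plan on the board

-- The link between local names and real vertices. All names are placed before the stage begins, so
-- a single `b` bounds the board throughout it.
record Base (S : Setting) (i : ℕ) (B₀ : Board) : Set where
  open Setting S
  field
    φ        : ℕ → Vertex
    φ-inj    : ∀ {u v} → φ u ≡ φ v → u ≡ v
    {b}      : ℕ
    φ<b      : ∀ {u} → u < names → φ u < b
    board<b  : Below b B₀
    clock    : budget + length B₀ ≤ suc i * 6
    main     : GreenPath B₀ (φ 0) (φ last) (i * 4) (_< b)
    off-main : ∀ {u} → u ≢ 0 → u ≢ last → φ u ∉ φ 0 ∷ GreenPath.xs main
    apart    : ∀ {u v} → fresh ≤ u ⊎ fresh ≤ v ⊎ (u ≡ 1 × v ≡ 2) → ¬ Adjacent B₀ (φ u) (φ v)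
    inc      : All (λ u → Inc B₀ colour (φ u)) coloured

module Execute {N i} (i<N : i < N) {S B₀} (base : Base S i B₀)
  (winCalm : ∀ {B} → Calm (suc i) B → Tree (Goal N) B)
  (winHot : ∀ {B} → Hot (suc i) B → Tree (Goal N) B) where

  open Setting S
  open Local S
  open Base base
  open GreenPath main using () renaming (xs to ps)

  rename : ColEdge → ColEdge
  rename (u , v , c) = φ u , φ v , c

  board : Board → Board
  board E = map rename E ++ B₀

  Proper : Board → Set
  Proper = All λ e → proj₁ e ≢ proj₁ (proj₂ e) × proj₁ e < names × proj₁ (proj₂ e) < names

  length-board : ∀ E → length (board E) ≡ length E + length B₀
  length-board E = trans (length-++ (map rename E)) (cong (_+ length B₀) (length-map rename E))

  board-clock : ∀ E {n} → length E ≤ n + budget → length (board E) ≤ n + suc i * 6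
  board-clock E {n} h = begin
    length (board E)           ≡⟨ length-board E ⟩
    length E + length B₀       ≤⟨ +-monoˡ-≤ (length B₀) h ⟩
    n + budget + length B₀     ≡⟨ +-assoc n budget (length B₀) ⟩
    n + (budget + length B₀)   ≤⟨ +-monoʳ-≤ n clock ⟩
    n + suc i * 6              ∎
    where open ≤-Reasoning

  old : ∀ E {c u v} → HasEdge B₀ c u v → HasEdge (board E) c u v
  old E = Any.++⁺ʳ (map rename E)

  new : ∀ {E c u v} → HasEdge E c u v → HasEdge (board E) c (φ u) (φ v)
  new h = Any.++⁺ˡ (Any.map⁺ (Any.map
    (λ { (refl , inj₁ (refl , refl)) → refl , inj₁ (refl , refl)
       ; (refl , inj₂ (refl , refl)) → refl , inj₂ (refl , refl) }) h))

  board-below : ∀ {E} → Proper E → Below b (board E)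
  board-below proper = All.++⁺ (All.map⁺ (All.map (λ (_ , p , q) → φ<b p , φ<b q) proper)) board<b

  board-apart : ∀ {E u v} → Apart E u v → ¬ Adjacent (board E) (φ u) (φ v)
  board-apart {E} (free , ¬joined) (c , h) with Any.++⁻ (map rename E) h
  ... | inj₂ h₀ = apart free (c , h₀)
  ... | inj₁ h₁ = ¬joined (Any.map
    (λ { (_ , inj₁ (p , q)) → inj₁ (φ-inj p , φ-inj q)
       ; (_ , inj₂ (p , q)) → inj₂ (φ-inj p , φ-inj q) }) (Any.map⁻ h₁))

  board-inc : ∀ {E c u} → Proper E → Touches E c u → Inc (board E) c (φ u)
  board-inc {E} _ (inj₂ (refl , u∈)) with All.lookup inc u∈
  ... | w , w≢ , h = w , w≢ , old E h
  board-inc ((a≢b , _) ∷ _) (inj₁ (here (refl , inj₁ refl))) =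
    _ , (λ eq → a≢b (φ-inj (sym eq))) , here (refl , inj₁ (refl , refl))
  board-inc ((a≢b , _) ∷ _) (inj₁ (here (refl , inj₂ refl))) =
    _ , (λ eq → a≢b (φ-inj eq)) , here (refl , inj₂ (refl , refl))
  board-inc (_ ∷ proper) (inj₁ (there t)) = inc-∷ (board-inc proper (inj₁ t))

  legal : ∀ {E u v} → Admissible E u v → Legal (board E) (φ u , φ v)
  legal (_ , _ , _ , u≢v , ap) = u≢v ∘ φ-inj , board-apart ap

  On : List ℕ → Vertex → Set
  On used v = v ∈ φ 0 ∷ ps ⊎ ∃ λ u → u ∈ used × u < names × v ≡ φ u

  on-∷ : ∀ {used u v} → On used v → On (u ∷ used) v
  on-∷ (inj₁ p) = inj₁ p
  on-∷ (inj₂ (u , p , q)) = inj₂ (u , there p , q)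

  on-new : ∀ {used u} → Off used u → On (u ∷ used) (φ u)
  on-new (u< , _) = inj₂ (_ , here refl , u< , refl)

  off : ∀ {used u} → Off used u → ¬ On used (φ u)
  off (_ , u≢0 , u≢l , _) (inj₁ p) = off-main u≢0 u≢l p
  off {used} (_ , _ , _ , u∉) (inj₂ (w , w∈ , _ , eq)) =
    u∉ (subst (_∈ used) (sym (φ-inj eq)) w∈)

  on<b : ∀ {used v} → On used v → v < b
  on<b (inj₁ p) = All.lookup (GreenPath.within main) p
  on<b (inj₂ (u , _ , u< , refl)) = φ<b u<

  growHead : ∀ {E y n used} a us → Grows E used a us →
    GreenPath (board E) (φ a) y n (On used) →
    GreenPath (board E) (φ (lastOf a us)) y (length us + n) (On (us ʳ++ used))
  growHead a [] _ P = P
  growHead {n = n} a (u ∷ us) (o , h , g) P = castLength (+-suc (length us) n)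
    (growHead u us g (extend-head P (off o) (new h) on-∷ (on-new o)))

  growLast : ∀ {E x n used} a us → Grows E used a us →
    GreenPath (board E) x (φ a) n (On used) →
    GreenPath (board E) x (φ (lastOf a us)) (length us + n) (On (us ʳ++ used))
  growLast a [] _ P = P
  growLast {n = n} a (u ∷ us) (o , h , g) P = castLength (+-suc (length us) n)
    (growLast u us g (extend-last P (off o) (new h) on-∷ (on-new o)))

  main-On : ∀ E → GreenPath (board E) (φ 0) (φ last) (i * 4) (On [])
  main-On E = record
    { xs     = ps
    ; path   = proj₁ path , consecutive-mono (old E) (φ 0 ∷ ps) (proj₂ path)
    ; last≡  = last≡
    ; len    = len
    ; within = All.tabulate inj₁
    }
    where open GreenPath main

  extended : ∀ {E L R} → Extends E L R →
    GreenPath (board E) (φ (lastOf 0 L)) (φ (lastOf last R)) (suc i * 4) (On (R ʳ++ (L ʳ++ [])))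
  extended {E} {L} {R} (four , gL , gR) =
    castLength (trans (sym (+-assoc (length R) (length L) (i * 4))) (cong (_+ i * 4) four))
      (growLast last R gR (growHead 0 L gL (main-On E)))

  lost : ∀ {E u v c} → NonGreen c → Proper E → Admissible E u v →
    Touches E c u ⊎ Touches E c v → Goal N ((φ u , φ v , c) ∷ board E)
  lost {E} {u} {v} {c} ng proper adm t = inj₁
    -- Before the move at most `budget` rounds of the stage are spent, so the P₃ comes by round 6(i
    -- + 1) + 1, which `i<N` keeps within the limit.
    (≤-trans (board-clock ((u , v , c) ∷ E) {1} (s≤s (proj₁ adm))) (s≤s (*-monoˡ-≤ 6 i<N)) , mono ng P)
    where
    P : HasMonoPath ((φ u , φ v , c) ∷ board E) c 3
    P = clash-path (legal adm) ([ inj₁ ∘ board-inc proper , inj₂ ∘ board-inc proper ]′ t)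
    mono : ∀ {c B} → NonGreen c → HasMonoPath B c 3 → HasMonoPath B red 3 ⊎ HasMonoPath B blue 3
    mono red = inj₁
    mono blue = inj₂

  execute : ∀ E T → Proper E → Valid E T → Tree (Goal N) (board E)
  execute E (calm L R) proper (time , ext) =
    winCalm (calm (board-clock E {0} time) (board-below proper) (weaken on<b (extended ext)))
  execute E (hot L R z) proper (time , ext , twins , o , ap) = winHot ([ hot′ red , hot′ blue ]′ twins)
    where
    P = extended {E} {L} {R} ext
    hot′ : ∀ {c} → NonGreen c → Twins E (lastOf 0 L) z c → Hot (suc i) (board E)
    hot′ ng (th , tz) = record
      { clock = board-clock E {1} time ; board<b = board-below proper ; main = weaken on<b P
      ; nonGreen = ng ; x-inc = board-inc proper th ; z-inc = board-inc proper tz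
      ; z<b = φ<b (proj₁ o) ; z∉ = off o ∘ All.lookup (GreenPath.within P) ; y≁z = board-apart ap }
  execute E (ask u v r b′ g) proper (adm@(_ , u< , v< , u≢v , _) , vr , vb , vg) =
    move (φ u) (φ v) (legal adm) answer
    where
    proper′ : ∀ {c} → Proper ((u , v , c) ∷ E)
    proper′ = (u≢v , u< , v<) ∷ proper
    answer : ∀ c → Tree (Goal N) ((φ u , φ v , c) ∷ board E)
    answer red   = [ done ∘ lost red proper adm , execute _ r proper′ ]′ vr
    answer blue  = [ done ∘ lost blue proper adm , execute _ b′ proper′ ]′ vb
    answer green = execute _ g proper′ vg

-- Turning positions into starting points of a stage

place : (x y z b : Vertex) → ℕ → Vertex
place x y z b 0 = x
place x y z b 1 = y
place x y z b 2 = z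
place x y z b (suc (suc (suc u))) = b + u

module _ {x y z b} (x≢y : x ≢ y) (x≢z : x ≢ z) (y≢z : y ≢ z) (x<b : x < b) (y<b : y < b) (z<b : z < b) where

  place-inj : ∀ {u v} → place x y z b u ≡ place x y z b v → u ≡ v
  place-inj {0} {0} _ = refl
  place-inj {0} {1} e = ⊥-elim (x≢y e)
  place-inj {0} {2} e = ⊥-elim (x≢z e)
  place-inj {0} {suc (suc (suc v))} e = ⊥-elim (m+n≮m b v (subst (_< b) e x<b))
  place-inj {1} {0} e = ⊥-elim (x≢y (sym e))
  place-inj {1} {1} _ = refl
  place-inj {1} {2} e = ⊥-elim (y≢z e)
  place-inj {1} {suc (suc (suc v))} e = ⊥-elim (m+n≮m b v (subst (_< b) e y<b))
  place-inj {2} {0} e = ⊥-elim (x≢z (sym e))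
  place-inj {2} {1} e = ⊥-elim (y≢z (sym e))
  place-inj {2} {2} _ = refl
  place-inj {2} {suc (suc (suc v))} e = ⊥-elim (m+n≮m b v (subst (_< b) e z<b))
  place-inj {suc (suc (suc u))} {0} e = ⊥-elim (m+n≮m b u (subst (_< b) (sym e) x<b))
  place-inj {suc (suc (suc u))} {1} e = ⊥-elim (m+n≮m b u (subst (_< b) (sym e) y<b))
  place-inj {suc (suc (suc u))} {2} e = ⊥-elim (m+n≮m b u (subst (_< b) (sym e) z<b))
  place-inj {suc (suc (suc u))} {suc (suc (suc v))} e = cong (3 +_) (+-cancelˡ-≡ b u v e)

  place< : ∀ {u} → u < names → place x y z b u < b + names
  place< {0} _ = m≤n⇒m≤n+o names x<b
  place< {1} _ = m≤n⇒m≤n+o names y<b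
  place< {2} _ = m≤n⇒m≤n+o names z<b
  place< {suc (suc (suc u))} u< = +-monoʳ-< b (≤-trans (m≤n+m (suc u) 3) u<)

-- At least one edge is essential: on a single vertex the ends coincide, which is why the empty
-- board has its own plan and base.
ends-distinct : ∀ {B x y ℓ On} (P : GreenPath B x y (suc ℓ) On) → x ≢ y
ends-distinct {x = x} (greenPath (v ∷ vs) (x∉ ∷ _ , _) refl _ _) = All.lookup x∉ (lastOf-∈ v vs)

stageBase : ∀ {i B b x y z} budget colour coloured
  (P : GreenPath B x y (suc i * 4) (_< b)) → Below b B →
  z < b → z ∉ x ∷ GreenPath.xs P → ¬ Adjacent B y z →
  budget + length B ≤ suc (suc i) * 6 →
  All (λ u → Inc B colour (place x y z b u)) coloured →
  Base (record { last = 1 ; fresh = 3 ; budget = budget ; colour = colour ; coloured = coloured }) (suc i) B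
stageBase {i} {B} {b} {x} {y} {z} budget colour coloured P board<b z<b z∉ y≁z clock inc = record
  { φ        = φ
  ; φ-inj    = place-inj x≢y x≢z y≢z x<b y<b z<b
  ; φ<b      = place< x≢y x≢z y≢z x<b y<b z<b
  ; board<b  = below-mono (m≤m+n b names) board<b
  ; clock    = clock
  ; main     = weaken (m≤n⇒m≤n+o names) P
  ; off-main = off-main
  ; apart    = apart
  ; inc      = inc
  }
  where
  open GreenPath P
  φ = place x y z b
  y∈ : y ∈ x ∷ xs
  y∈ = subst (_∈ x ∷ xs) last≡ (lastOf-∈ x xs)
  x<b = All.lookup within (here refl)
  y<b = All.lookup within y∈
  x≢y = ends-distinct P
  x≢z : x ≢ z
  x≢z refl = z∉ (here refl)
  y≢z : y ≢ z
  y≢z refl = z∉ y∈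
  off-main : ∀ {u} → u ≢ 0 → u ≢ 1 → φ u ∉ x ∷ xs
  off-main {0} ≢0 _ = ⊥-elim (≢0 refl)
  off-main {1} _ ≢1 = ⊥-elim (≢1 refl)
  off-main {2} _ _ = z∉
  off-main {suc (suc (suc u))} _ _ p = m+n≮m b u (All.lookup within p)
  fresh≁ : ∀ {u} → 3 ≤ u → ¬ φ u < b
  fresh≁ {suc (suc (suc u))} _ = m+n≮m b u
  fresh≁ {suc zero} (s≤s ())
  fresh≁ {suc (suc zero)} (s≤s (s≤s ()))
  apart : ∀ {u v} → 3 ≤ u ⊎ 3 ≤ v ⊎ (u ≡ 1 × v ≡ 2) → ¬ Adjacent B (φ u) (φ v)
  apart (inj₁ p) a = fresh≁ p (proj₁ (adjacent-below board<b a))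
  apart (inj₂ (inj₁ p)) a = fresh≁ p (proj₂ (adjacent-below board<b a))
  apart (inj₂ (inj₂ (refl , refl))) = y≁z

calmBase : ∀ {i B} → Calm (suc i) B → Base calmSetting (suc i) B
calmBase {i} C = stageBase {i} {z = b} 6 green [] (weaken m<n⇒m<1+n main) (below-mono (n≤1+n b) board<b)
  ≤-refl (λ p → <-irrefl refl (All.lookup within p)) (λ a → <-irrefl refl (proj₂ (adjacent-below board<b a)))
  (+-monoʳ-≤ 6 clock) []
  where open Calm C
        open GreenPath main

startBase : Base start 0 []
startBase = record
  { φ        = id
  ; φ-inj    = id
  ; φ<b      = id
  ; board<b  = []
  ; clock    = ≤-refl
  ; main     = record { xs = [] ; path = [] ∷ [] , tt ; last≡ = refl ; len = refl ; within = s≤s z≤n ∷ [] }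
  ; off-main = λ { u≢0 _ (here u≡0) → u≢0 u≡0 }
  ; apart    = λ { _ (_ , ()) }
  ; inc      = []
  }

hotBase : ∀ {i B} (H : Hot (suc i) B) → Base (hotSetting (Hot.c H)) (suc i) B
hotBase H = stageBase 5 c (0 ∷ 2 ∷ []) main board<b z<b z∉ y≁z (+-monoʳ-≤ 5 clock) (x-inc ∷ z-inc ∷ [])
  where open Hot H

-- Induction over the stages

winCalm : ∀ {N} j {i B} → j + suc i ≡ N → Calm (suc i) B → Tree (Goal N) B
winHot : ∀ {N} j {i B} → j + suc i ≡ N → Hot (suc i) B → Tree (Goal N) B
-- The recursion descends on the number of stages still to come, while `i` grows; the leaves of the
-- plan continue with `j` stages left.
stage : ∀ {N} j {i B S} → suc j + i ≡ N → Base S i B → ∀ T → Local.Valid S [] T → Tree (Goal N) B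

winCalm zero refl C = done (calm-goal C)
winCalm (suc j) eq C = stage j eq (calmBase C) calmPlan calmPlan-valid

winHot zero refl H = done (hot-goal H)
winHot (suc j) eq H with Hot.c H | Hot.nonGreen H | hotBase H
... | _ | red  | base = stage j eq base (hotPlan 2) hotPlan-valid-red
... | _ | blue | base = stage j eq base (swap (hotPlan 2)) hotPlan-valid-blue

stage {N} j {i} eq base T valid = execute [] T [] valid
  where
  eq′ : j + suc i ≡ N
  eq′ = trans (+-suc j i) eq
  open Execute {N} (subst (i <_) eq (s≤s (m≤n+m i j))) base (winCalm j eq′) (winHot j eq′)

winStart : ∀ n → Tree (Goal (suc n)) []
winStart n = stage n (cong suc (+-identityʳ n)) startBase startPlan startPlan-valid

treeOutcome : ∀ {N r s ℓ} → r ≡ suc (N * 6) → s ≡ N * 6 → ℓ ≡ suc (N * 4) → Tree (Goal N) [] →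
  Σ BuilderStrategy λ b → (p : PainterStrategy) →
    (∃ λ n → n ≤ r × (HasMonoPath (play b p n) red 3 ⊎ HasMonoPath (play b p n) blue 3))
  ⊎ (∃ λ n → n ≤ s × HasBadGreenPath (play b p n) ℓ)
  ⊎ (∃ λ n → n ≤ r × HasGoodGreenPath (play b p n) ℓ)
treeOutcome {N} refl refl refl root = strategy , λ p → outcome p (reaches p)
  where
  open Strategy root
  outcome : ∀ p → (∃ λ n → Goal N (play strategy p n)) → _
  outcome p (n , inj₁ (t , g))        = inj₁ (n , subst (_≤ _) (length-play strategy p n) t , g)
  outcome p (n , inj₂ (inj₁ (t , g))) = inj₂ (inj₁ (n , subst (_≤ _) (length-play strategy p n) t , g))
  outcome p (n , inj₂ (inj₂ (t , g))) = inj₂ (inj₂ (n , subst (_≤ _) (length-play strategy p n) t , g))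

theorem3p7 : (k : ℕ) → 2 ≤ k →
    Σ BuilderStrategy λ b → (p : PainterStrategy) →
    (∃ λ n → n ≤ 6 * k ∸ 5 ×
    (HasMonoPath (play b p n) red 3 ⊎ HasMonoPath (play b p n) blue 3))
    ⊎ (∃ λ n → n ≤ 6 * k ∸ 6 × HasBadGreenPath (play b p n) (4 * k ∸ 3))
    ⊎ (∃ λ n → n ≤ 6 * k ∸ 5 × HasGoodGreenPath (play b p n) (4 * k ∸ 3))
theorem3p7 (suc (suc m)) (s≤s (s≤s z≤n)) = treeOutcome {suc m}
  -- After commutation the product unfolds to `6 + suc m * 6` or `4 + suc m * 4`, so the truncated
  -- subtractions compute.
  (cong (_∸ 5) (*-comm 6 (2 + m))) (cong (_∸ 6) (*-comm 6 (2 + m))) (cong (_∸ 3) (*-comm 4 (2 + m)))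
  (winStart m)
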